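{- Let $G$ be a graph that is not a clique, and let $\mathcal{C}$ be a circle representation for $G$. Let $\mathcal{C}_{\emptyset}$ be the set of peripheral chords of $\mathcal{C}$ and let $G_{\mathcal{C}_{\emptyset}}$ be the intersection graph of $\mathcal{C}_{\emptyset}$. Then $\psi_r(\mathcal{C}) = \kappa(G_{\mathcal{C}_{\emptyset}})$.
   Context: All graphs are finite, simple and undirected. A circle representation of a graph $G$ is a set of chords of a circle, one per vertex, with all chord endpoints distinct, such that two vertices are adjacent if and only if their chords intersect. The two endpoints of a chord split the circle into two open arcs (the arcs of the chord). An open arc of the circle is empty if it does not contain both endpoints of any chord of the representation. A chord is peripheral if at least one of its two arcs is empty. Corners are points of the circle distinct from all chord endpoints; a set of corners satisfies a chord if each of the two arcs of the chord contains a corner. $\psi_r(\mathcal{C})$, the polygon number of the circle representation $\mathcal{C}$, is the minimum number of corners that must be added to $\mathcal{C}$ so that every chord of $\mathcal{C}$ is satisfied. $\kappa(H)$ denotes the minimum number of cliques needed to cover (partition) the vertex set of a graph $H$. -}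

module Defs where

open import Data.Nat using (ℕ; _<_; _≤_)
open import Data.Fin using (Fin)
open import Data.Product using (Σ; _×_; ∃; ∃-syntax)
open import Data.Sum using (_⊎_)
open import Data.List using (List; length)
open import Data.List.Membership.Propositional using (_∈_)
open import Relation.Nullary using (¬_)
open import Relation.Binary.PropositionalEquality using (_≡_; _≢_)
open import Function.Bundles using (_⇔_)

-- A circle representation with n chords (one per vertex of Fin n).
-- The circle is cut open at a point that is not an endpoint; endpoints are
-- natural numbers, their circular order being the order of ℕ (with wrap-around).
-- Chord v has endpoints lo v < hi v, and all 2n endpoints are distinct.
record CircleRep (n : ℕ) : Set where
  field
    lo hi    : Fin n → ℕ
    lo<hi    : ∀ v → lo v < hi v
    lo-inj   : ∀ u v → lo u ≡ lo v → u ≡ v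
    hi-inj   : ∀ u v → hi u ≡ hi v → u ≡ v
    lo≢hi    : ∀ u v → lo u ≢ hi v
open CircleRep public

module _ {n : ℕ} (C : CircleRep n) where

  Cross : Fin n → Fin n → Set
  Cross u v = (lo C u < lo C v × lo C v < hi C u × hi C u < hi C v)
            ⊎ (lo C v < lo C u × lo C u < hi C v × hi C v < hi C u)

  -- The two open arcs of chord v: inner arc (lo v, hi v) and the outer arc
  -- (points before lo v or after hi v, wrapping around).
  -- Chord w has both endpoints in the inner arc of v:
  InInner : Fin n → Fin n → Set
  InInner w v = lo C v < lo C w × hi C w < hi C v
  InOuter : Fin n → Fin n → Set
  InOuter w v = hi C w < lo C v ⊎ hi C v < lo C w ⊎ (lo C w < lo C v × hi C v < hi C w)

  InnerEmpty OuterEmpty Peripheral : Fin n → Set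
  InnerEmpty v = ∀ w → ¬ InInner w v
  OuterEmpty v = ∀ w → ¬ InOuter w v
  Peripheral v = InnerEmpty v ⊎ OuterEmpty v

  -- A corner is encoded by c : ℕ, standing for the circle point c + 1/2
  -- (never an endpoint). Every gap between consecutive endpoints contains
  -- such a point, so this loses no generality.
  -- Corner c lies in the inner arc of v iff lo v < c + 1/2 < hi v.
  Satisfies : List ℕ → Fin n → Set
  Satisfies cs v = (∃[ c ] (c ∈ cs × lo C v ≤ c × c < hi C v))
                 × (∃[ c ] (c ∈ cs × (c < lo C v ⊎ hi C v ≤ c)))

  SatisfiesAll : List ℕ → Set
  SatisfiesAll cs = ∀ v → Satisfies cs v

  IsPolygonNumber : ℕ → Set
  IsPolygonNumber k = (∃[ cs ] (SatisfiesAll cs × length cs ≡ k))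
                    × (∀ cs → SatisfiesAll cs → k ≤ length cs)

  -- A partition of the peripheral chords into (at most) k cliques of their
  -- intersection graph G_{C∅}: a labelling by Fin k where distinct
  -- peripheral chords with the same label intersect.
  PeripheralCliqueCover : ℕ → Set
  PeripheralCliqueCover k =
    Σ (Fin n → Fin k) λ col →
      ∀ u v → Peripheral u → Peripheral v → u ≢ v → col u ≡ col v → Cross u v

  IsPeripheralCliqueCoverNumber : ℕ → Set
  IsPeripheralCliqueCoverNumber k =
    PeripheralCliqueCover k × (∀ m → PeripheralCliqueCover m → k ≤ m)

record Graph (n : ℕ) : Set₁ where
  field
    Adj       : Fin n → Fin n → Set
    Adj-sym   : ∀ u v → Adj u v → Adj v u
    Adj-irr   : ∀ v → ¬ Adj v v
open Graph public

IsClique : ∀ {n} → Graph n → Set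
IsClique G = ∀ u v → u ≢ v → Adj G u v

Represents : ∀ {n} → CircleRep n → Graph n → Set
Represents C G = ∀ u v → Adj G u v ⇔ Cross C u v

{-# OPTIONS --safe #-}
module Submission where

-- Cover the circle by a line, so that each arc of a chord becomes a family of
-- intervals, periodic with period L.  Let E e be the least end of an interval
-- starting at or after e.  Placing corners greedily just before E e, E² e, …
-- satisfies every chord with k corners as soon as e + L ≤ Eᵏ e for some e, so
-- it remains to derive this from a cover of the peripheral chords by k cliques.
--
-- Suppose Eᵏ e < e + L for all e.  The intervals picked by the greedy orbit of 0
-- belong to peripheral chords, and any k consecutive ones come from pairwise
-- non-crossing chords, hence from distinct cliques; by pigeonhole the sequence
-- of cliques has period k.  Since Eᵏ falls short of a full turn each time, some
-- interval whose index is a multiple of k slips back behind a translate of the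
-- first one; if k ≥ 2 the two are disjoint, although their chords lie in the
-- same clique.  The cases k ≤ 1 are excluded by a pair of non-crossing chords.
--
-- Conversely, peripheral chords whose empty arcs share a corner cross, so the
-- corners of a satisfying set label a clique cover.

open import Defs
open import Data.Empty using (⊥; ⊥-elim)
open import Data.Fin using (Fin; zero; suc; toℕ; fromℕ<)
open import Data.Fin.Properties
  using (any?; all?; pigeonhole; toℕ<n; toℕ-fromℕ<)
open import Data.List using (length; lookup; map; upTo)
open import Data.List.Membership.Propositional using (_∈_)
open import Data.List.Membership.Propositional.Properties using (∈-map⁺; ∈-upTo⁺)
open import Data.List.Properties using (length-map; length-upTo)
open import Data.List.Relation.Unary.Any using (index)
open import Data.List.Relation.Unary.Any.Properties using (lookup-index)
open import Data.Nat
open import Data.Nat.DivMod using (_/_; _%_; m≡m%n+[m/n]*n; [m+kn]%n≡m%n; m<n⇒m%n≡m; m%n<n)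
open import Data.Nat.GeneralisedArithmetic using (fold; fold-+)
open import Data.Nat.Properties
open import Data.Product using (_×_; _,_; ∃₂; ∃-syntax; proj₁; proj₂)
open import Data.Sum using (_⊎_; inj₁; inj₂)
open import Function using (_∘_; case_of_)
open import Function.Bundles using (Equivalence)
open import Relation.Binary.PropositionalEquality
open import Relation.Binary using (tri<; tri≈; tri>)
open import Relation.Nullary using (¬_; yes; no; contradiction; ¬?; _×-dec_; _⊎-dec_; map′)
open import Relation.Unary using (Decidable)

-- Searches and bounds in `ℕ`.

least : {P : ℕ → Set} → Decidable P → ∀ m → P m → ∃[ k ] (P k × (∀ j → P j → k ≤ j))
least P? m pm with P? 0
... | yes p0 = 0 , p0 , λ _ _ → z≤n
least P? zero    pm | no ¬p0 = contradiction pm ¬p0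
least {P} P? (suc m) pm | no ¬p0 with least (P? ∘ suc) m pm
... | k , pk , min = suc k , pk , min′
  where
  min′ : ∀ j → P j → suc k ≤ j
  min′ zero    p = contradiction p ¬p0
  min′ (suc j) p = s≤s (min j p)

firstStep : {P : ℕ → Set} → Decidable P → ¬ P 0 → ∀ m → P m →
  ∃[ j ] (j < m × ¬ P j × P (suc j))
firstStep P? ¬p0 zero    pm = contradiction pm ¬p0
firstStep P? ¬p0 (suc m) pm with P? m
... | no ¬pm = m , ≤-refl , ¬pm , pm
... | yes p  with firstStep P? ¬p0 m p
...   | j , j<m , ¬pj , psj = j , m<n⇒m<1+n j<m , ¬pj , psj

boundedAbove : ∀ {n} (f : Fin n → ℕ) → ∃[ L ] (∀ v → f v < L)
boundedAbove {zero}  f = 0 , λ ()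
boundedAbove {suc n} f with boundedAbove (f ∘ suc)
... | L , f<L = suc (f zero) ⊔ L , λ where
  zero    → m≤m⊔n (suc (f zero)) L
  (suc v) → ≤-trans (f<L v) (m≤n⊔m (suc (f zero)) L)

-- Crossing and non-crossing chords; clique covers from corners.

module _ {n : ℕ} (C : CircleRep n) where

  data Separated (u v : Fin n) : Set where
    before : hi C u < lo C v → Separated u v
    inside : lo C v < lo C u → hi C u < hi C v → Separated u v

  cross-or-separated : ∀ {u v} → u ≢ v → Cross C u v ⊎ Separated u v ⊎ Separated v u
  cross-or-separated {u} {v} u≢v
    with <-cmp (lo C u) (lo C v) | <-cmp (hi C u) (hi C v)
       | <-cmp (hi C u) (lo C v) | <-cmp (hi C v) (lo C u)
  ... | tri≈ _ e _ | _ | _ | _ = contradiction (lo-inj C u v e) u≢v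
  ... | _ | tri≈ _ e _ | _ | _ = contradiction (hi-inj C u v e) u≢v
  ... | _ | _ | tri≈ _ e _ | _ = contradiction (sym e) (lo≢hi C v u)
  ... | _ | _ | _ | tri≈ _ e _ = contradiction (sym e) (lo≢hi C u v)
  ... | _ | _ | tri< l _ _ | _ = inj₂ (inj₁ (before l))
  ... | _ | _ | _ | tri< l _ _ = inj₂ (inj₂ (before l))
  ... | tri< l _ _ | tri< h _ _ | tri> _ _ m | _ = inj₁ (inj₁ (l , m , h))
  ... | tri> _ _ l | tri> _ _ h | _ | tri> _ _ m = inj₁ (inj₂ (l , m , h))
  ... | tri< l _ _ | tri> _ _ h | _ | _ = inj₂ (inj₂ (inside l h))
  ... | tri> _ _ l | tri< h _ _ | _ | _ = inj₂ (inj₁ (inside l h))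

  InEmptyArc : ℕ → Fin n → Set
  InEmptyArc c v = (InnerEmpty C v × lo C v ≤ c × c < hi C v)
                 ⊎ (OuterEmpty C v × (c < lo C v ⊎ hi C v ≤ c))

  -- For non-crossing chords, each has one arc that contains the other chord and so is not empty;
  -- the two remaining arcs are disjoint.
  separated-share-no-corner : ∀ {c u v} → Separated u v → InEmptyArc c u → ¬ InEmptyArc c v
  separated-share-no-corner (before u<v) (inj₁ (_ , _ , c<u)) (inj₁ (_ , v≤c , _)) =
    <-asym u<v (≤-<-trans v≤c c<u)
  separated-share-no-corner {u = u} (before u<v) _ (inj₂ (oe , _)) = oe u (inj₁ u<v)
  separated-share-no-corner {v = v} (before u<v) (inj₂ (oe , _)) _ = oe v (inj₂ (inj₁ u<v))
  separated-share-no-corner {u = u} (inside l h) _ (inj₁ (ie , _)) = ie u (l , h)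
  separated-share-no-corner (inside l h) (inj₁ (_ , u≤c , _)) (inj₂ (_ , inj₁ c<v)) =
    <-asym l (≤-<-trans u≤c c<v)
  separated-share-no-corner (inside l h) (inj₁ (_ , _ , c<u)) (inj₂ (_ , inj₂ v≤c)) =
    <-asym h (≤-<-trans v≤c c<u)
  separated-share-no-corner {v = v} (inside l h) (inj₂ (oe , _)) (inj₂ _) =
    oe v (inj₂ (inj₂ (l , h)))

  shared-corner⇒cross : ∀ {c u v} → u ≢ v → InEmptyArc c u → InEmptyArc c v → Cross C u v
  shared-corner⇒cross u≢v cu cv with cross-or-separated u≢v
  ... | inj₁ x        = x
  ... | inj₂ (inj₁ s) = contradiction cv (separated-share-no-corner s cu)
  ... | inj₂ (inj₂ s) = contradiction cu (separated-share-no-corner s cv)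

  innerEmpty? : Decidable (InnerEmpty C)
  innerEmpty? v = all? λ w → ¬? ((lo C v <? lo C w) ×-dec (hi C w <? hi C v))

  corners⇒cover : ∀ cs → SatisfiesAll C cs → PeripheralCliqueCover C (length cs)
  corners⇒cover cs sat = (λ v → proj₁ (label v)) , λ u v pu pv u≢v eq →
    shared-corner⇒cross u≢v (proj₂ (label u) pu)
      (subst (λ i → InEmptyArc (lookup cs i) v) (sym eq) (proj₂ (label v) pv))
    where
    label : ∀ v → ∃[ i ] (Peripheral C v → InEmptyArc (lookup cs i) v)
    label v with innerEmpty? v | sat v
    ... | yes ie | (c , c∈cs , in-inner) , _ = index c∈cs , λ _ →
      subst (λ c → InEmptyArc c v) (lookup-index c∈cs) (inj₁ (ie , in-inner))
    -- A peripheral chord whose inner arc is not empty has an empty outer arc. A chord that is not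
    -- peripheral also gets this label, as a mere default.
    ... | no ¬ie | _ , (c , c∈cs , in-outer) = index c∈cs , λ where
      (inj₁ ie) → contradiction ie ¬ie
      (inj₂ oe) → subst (λ c → InEmptyArc c v) (lookup-index c∈cs) (inj₂ (oe , in-outer))

  -- Non-crossing in the form that disjoint lifted arcs yield: weak where the arc of `u` may touch
  -- that of `v`, strict where the arc of `v` ends before the next copy of the arc of `u`.
  data Apart (u v : Fin n) : Set where
    left   : hi C u ≤ lo C v → Apart u v
    right  : hi C v < lo C u → Apart u v
    within : hi C u ≤ hi C v → lo C v < lo C u → Apart u v
    around : lo C u ≤ lo C v → hi C v < hi C u → Apart u v

  apart⇒≢ : ∀ {u v} → Apart u v → u ≢ v
  apart⇒≢ {u} (left h≤l)    refl = <⇒≱ (lo<hi C u) h≤l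
  apart⇒≢ {u} (right h<l)   refl = <-asym (lo<hi C u) h<l
  apart⇒≢     (within _ l<) refl = <-irrefl refl l<
  apart⇒≢     (around _ h<) refl = <-irrefl refl h<

  apart⇒¬cross : ∀ {u v} → Apart u v → ¬ Cross C u v
  apart⇒¬cross     (left h≤l)    (inj₁ (_ , l<h , _)) = <⇒≱ l<h h≤l
  apart⇒¬cross {u} (left h≤l)    (inj₂ (l<l , _ , _)) =
    <-asym (lo<hi C u) (≤-<-trans h≤l l<l)
  apart⇒¬cross {u} {v} (right h<l) (inj₁ (l<l , _ , _)) =
    <-asym (lo<hi C v) (<-trans h<l l<l)
  apart⇒¬cross     (right h<l)   (inj₂ (_ , l<h , _)) = <-asym l<h h<l
  apart⇒¬cross     (within _ l<) (inj₁ (l , _ , _))   = <-asym l l<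
  apart⇒¬cross     (within h≤ _) (inj₂ (_ , _ , h))   = <⇒≱ h h≤
  apart⇒¬cross     (around _ h<) (inj₁ (_ , _ , h))   = <-asym h h<
  apart⇒¬cross     (around l≤ _) (inj₂ (l , _ , _))   = <⇒≱ l l≤

  -- Periodic lift of the arcs to the line.

  module Lift (L : ℕ) .{{_ : NonZero L}} (hi<L : ∀ v → hi C v < L) (v₀ : Fin n) where

    lo<L : ∀ v → lo C v < L
    lo<L v = <-trans (lo<hi C v) (hi<L v)

    -- The outer arc becomes a single interval by running on through the cut point into the next
    -- turn.
    data Arc (v : Fin n) : ℕ → ℕ → Set where
      inner : ∀ t → Arc v (lo C v + t * L) (hi C v + t * L)
      outer : ∀ t → Arc v (hi C v + t * L) (lo C v + suc t * L)

    +-suc-turn : ∀ x t → x + suc t * L ≡ x + t * L + L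
    +-suc-turn x t = trans (cong (x +_) (+-comm L (t * L))) (sym (+-assoc x (t * L) L))

    <-suc-turn : ∀ {y} x t → y < x + t * L + L → y < x + suc t * L
    <-suc-turn {y} x t = subst (y <_) (sym (+-suc-turn x t))

    turn-cancel-≤ : ∀ x {y} t t′ → y < L → x + t * L ≤ y + t′ * L → t ≤ t′
    turn-cancel-≤ x {y} t t′ y<L le = ≮⇒≥ λ t′<t → <⇒≱
      (+-monoˡ-< (t′ * L) y<L)
      (≤-trans (*-monoˡ-≤ L t′<t) (≤-trans (m≤n+m (t * L) x) le))

    hi-<-next-turn : ∀ v x t → hi C v + t * L < x + suc t * L
    hi-<-next-turn v x t = ≤-trans (+-monoˡ-< (t * L) (hi<L v)) (m≤n+m (suc t * L) x)

    arc-< : ∀ {v a b} → Arc v a b → a < b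
    arc-< {v} (inner t) = +-monoˡ-< (t * L) (lo<hi C v)
    arc-< {v} (outer t) = hi-<-next-turn v (lo C v) t

    arc-shift : ∀ {v a b} → Arc v a b → Arc v (a + L) (b + L)
    arc-shift {v} (inner t) =
      subst₂ (Arc v) (+-suc-turn (lo C v) t) (+-suc-turn (hi C v) t) (inner (suc t))
    arc-shift {v} (outer t) =
      subst₂ (Arc v) (+-suc-turn (hi C v) t) (+-suc-turn (lo C v) (suc t)) (outer (suc t))

    arc-unshift : ∀ {v a b} → Arc v a b → L ≤ a →
      ∃₂ λ a′ b′ → Arc v a′ b′ × a ≡ a′ + L × b ≡ b′ + L
    arc-unshift {v} (inner zero) L≤a =
      contradiction (subst (L ≤_) (+-identityʳ _) L≤a) (<⇒≱ (lo<L v))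
    arc-unshift {v} (outer zero) L≤a =
      contradiction (subst (L ≤_) (+-identityʳ _) L≤a) (<⇒≱ (hi<L v))
    arc-unshift {v} (inner (suc t)) _ =
      _ , _ , inner t , +-suc-turn (lo C v) t , +-suc-turn (hi C v) t
    arc-unshift {v} (outer (suc t)) _ =
      _ , _ , outer t , +-suc-turn (hi C v) t , +-suc-turn (lo C v) (suc t)

    -- The arc of `v` fits between the arc of `u` and its next translate. This fixes the turn of one
    -- relative to the other, up to two choices for inner arcs, and the common turn cancels.
    disjoint-arcs⇒apart : ∀ {u v a b a′ b′} → Arc u a b → Arc v a′ b′ →
      b ≤ a′ → b′ < a + L → Apart u v
    disjoint-arcs⇒apart {u} {v} (inner t) (inner t′) b≤a′ b′<a+L
      with b′<a″ ← <-suc-turn (lo C u) t b′<a+L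
      with m≤n⇒m<n∨m≡n (turn-cancel-≤ (hi C u) t t′ (lo<L v) b≤a′)
    ... | inj₂ refl = left (+-cancelʳ-≤ (t * L) _ _ b≤a′)
    ... | inj₁ t<t′
      with refl ← ≤-antisym t<t′ (turn-cancel-≤ (hi C v) t′ (suc t) (lo<L u) (<⇒≤ b′<a″)) =
      right (+-cancelʳ-< (suc t * L) _ _ b′<a″)
    disjoint-arcs⇒apart {u} {v} (inner t) (outer t′) b≤a′ b′<a+L
      with b′<a″ ← <-suc-turn (lo C u) t b′<a+L
      with refl ← ≤-antisym (turn-cancel-≤ (hi C u) t t′ (hi<L v) b≤a′)
             (s≤s⁻¹ (turn-cancel-≤ (lo C v) (suc t′) (suc t) (lo<L u) (<⇒≤ b′<a″))) =
      within (+-cancelʳ-≤ (t * L) _ _ b≤a′) (+-cancelʳ-< (suc t * L) _ _ b′<a″)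
    disjoint-arcs⇒apart {u} {v} (outer t) (inner t′) b≤a′ b′<a+L
      with b′<a″ ← <-suc-turn (hi C u) t b′<a+L
      with refl ← ≤-antisym (turn-cancel-≤ (lo C u) (suc t) t′ (lo<L v) b≤a′)
             (turn-cancel-≤ (hi C v) t′ (suc t) (hi<L u) (<⇒≤ b′<a″)) =
      around (+-cancelʳ-≤ (suc t * L) _ _ b≤a′) (+-cancelʳ-< (suc t * L) _ _ b′<a″)
    -- Outer arcs all contain the cut point, so two of them are never disjoint.
    disjoint-arcs⇒apart {u} {v} (outer t) (outer t′) b≤a′ b′<a+L =
      contradiction (turn-cancel-≤ (lo C u) (suc t) t′ (hi<L v) b≤a′)
        (≤⇒≯ (s≤s⁻¹ (turn-cancel-≤ (lo C v) (suc t′) (suc t) (hi<L u)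
          (<⇒≤ (<-suc-turn (hi C u) t b′<a+L)))))

    -- A chord with both endpoints in the arc would have an arc of its own nested there, starting no
    -- earlier and ending sooner.
    minimal-arc⇒peripheral : ∀ {v a b} → Arc v a b →
      (∀ {w a′ b′} → Arc w a′ b′ → a ≤ a′ → b ≤ b′) → Peripheral C v
    minimal-arc⇒peripheral (inner t) min = inj₁ λ w (l , h) →
      <⇒≱ (+-monoˡ-< (t * L) h) (min (inner t) (+-monoˡ-≤ (t * L) (<⇒≤ l)))
    minimal-arc⇒peripheral {v} (outer t) min = inj₂ λ where
      w (inj₁ h<l) → <⇒≱ (+-monoˡ-< (suc t * L) h<l)
        (min (inner (suc t)) (<⇒≤ (hi-<-next-turn v (lo C w) t)))
      w (inj₂ (inj₁ h<l)) → <⇒≱ (hi-<-next-turn w (lo C v) t)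
        (min (inner t) (+-monoˡ-≤ (t * L) (<⇒≤ h<l)))
      w (inj₂ (inj₂ (l , h))) → <⇒≱ (+-monoˡ-< (suc t * L) l)
        (min (outer t) (+-monoˡ-≤ (t * L) (<⇒≤ h)))

    -- The greedy step.

    ArcEnd : ℕ → ℕ → Set
    ArcEnd e b = ∃₂ λ v a → e ≤ a × Arc v a b

    t≤x+t*L : ∀ x t → t ≤ x + t * L
    t≤x+t*L x t = ≤-trans (m≤m*n t L) (m≤n+m (t * L) x)

    -- The turn of an arc is at most its end, because `L` is positive; so finitely many candidates
    -- suffice.
    arcEnd? : ∀ e → Decidable (ArcEnd e)
    arcEnd? e b = map′ to from (any? λ v → any? λ (t : Fin (suc b)) →
        ((e ≤? lo C v + toℕ t * L) ×-dec (hi C v + toℕ t * L ≟ b)) ⊎-dec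
        ((e ≤? hi C v + toℕ t * L) ×-dec (lo C v + suc (toℕ t) * L ≟ b)))
      where
      Bounded : Fin n → ℕ → ℕ → Set
      Bounded v b t = (e ≤ lo C v + t * L × hi C v + t * L ≡ b) ⊎
                      (e ≤ hi C v + t * L × lo C v + suc t * L ≡ b)

      to : (∃₂ λ v (t : Fin (suc b)) → Bounded v b (toℕ t)) → ArcEnd e b
      to (v , t , inj₁ (e≤a , eq)) = v , _ , e≤a , subst (Arc v _) eq (inner (toℕ t))
      to (v , t , inj₂ (e≤a , eq)) = v , _ , e≤a , subst (Arc v _) eq (outer (toℕ t))

      bounded : ∀ {v b} t → t ≤ b → Bounded v b t → ∃₂ λ v (t : Fin (suc b)) → Bounded v b (toℕ t)
      bounded {v} {b} t t≤b q =
        v , fromℕ< (s≤s t≤b) , subst (Bounded v b) (sym (toℕ-fromℕ< (s≤s t≤b))) q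

      from : ∀ {b} → ArcEnd e b → ∃₂ λ v (t : Fin (suc b)) → Bounded v b (toℕ t)
      from (v , _ , e≤a , inner t) = bounded t (t≤x+t*L (hi C v) t) (inj₁ (e≤a , refl))
      from (v , _ , e≤a , outer t) =
        bounded t (≤-trans (n≤1+n t) (t≤x+t*L (lo C v) (suc t))) (inj₂ (e≤a , refl))

    abstract
      leastEnd : ∀ e → ∃[ b ] (ArcEnd e b × (∀ b′ → ArcEnd e b′ → b ≤ b′))
      leastEnd e = least (arcEnd? e) _ (v₀ , _ , t≤x+t*L (lo C v₀) e , inner e)

    E : ℕ → ℕ
    E e = proj₁ (leastEnd e)

    Attains : Fin n → ℕ → Set
    Attains v e = ∃[ a ] (e ≤ a × Arc v a (E e))

    attained : ∀ e → ∃[ v ] Attains v e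
    attained e = proj₁ (proj₂ (leastEnd e))

    E-minimal : ∀ {e v a b} → e ≤ a → Arc v a b → E e ≤ b
    E-minimal {e} e≤a arc = proj₂ (proj₂ (leastEnd e)) _ (_ , _ , e≤a , arc)

    E-mono : ∀ {e e′} → e ≤ e′ → E e ≤ E e′
    E-mono {e′ = e′} e≤e′ with attained e′
    ... | _ , _ , e′≤a , arc = E-minimal (≤-trans e≤e′ e′≤a) arc

    E-increasing : ∀ e → e < E e
    E-increasing e with attained e
    ... | _ , _ , e≤a , arc = ≤-<-trans e≤a (arc-< arc)

    E-shift : ∀ e → E (e + L) ≡ E e + L
    E-shift e = ≤-antisym below above
      where
      below : E (e + L) ≤ E e + L
      below with attained e
      ... | _ , _ , e≤a , arc = E-minimal (+-monoˡ-≤ L e≤a) (arc-shift arc)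

      above : E e + L ≤ E (e + L)
      above with attained (e + L)
      ... | _ , a , e+L≤a , arc with arc-unshift arc (≤-trans (m≤n+m L e) e+L≤a)
      ...   | a′ , b′ , arc′ , a≡ , b≡ = subst (E e + L ≤_) (sym b≡)
                (+-monoˡ-≤ L (E-minimal (+-cancelʳ-≤ L _ _ (subst (e + L ≤_) a≡ e+L≤a)) arc′))

    attains-shift : ∀ {v e} → Attains v e → Attains v (e + L)
    attains-shift {v} {e} (a , e≤a , arc) =
      a + L , +-monoˡ-≤ L e≤a , subst (Arc v (a + L)) (sym (E-shift e)) (arc-shift arc)

    attains⇒peripheral : ∀ {v e} → Attains v e → Peripheral C v
    attains⇒peripheral (_ , e≤a , arc) =
      minimal-arc⇒peripheral arc λ arc′ a≤a′ → E-minimal (≤-trans e≤a a≤a′) arc′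

    E-shift* : ∀ q e → E (e + q * L) ≡ E e + q * L
    E-shift* zero    e = trans (cong E (+-identityʳ e)) (sym (+-identityʳ (E e)))
    E-shift* (suc q) e = begin
      E (e + suc q * L)   ≡⟨ cong E (+-suc-turn e q) ⟩
      E (e + q * L + L)   ≡⟨ E-shift (e + q * L) ⟩
      E (e + q * L) + L   ≡⟨ cong (_+ L) (E-shift* q e) ⟩
      E e + q * L + L     ≡⟨ +-suc-turn (E e) q ⟨
      E e + suc q * L     ∎
      where open ≡-Reasoning

    attains-shift* : ∀ {v} q → Attains v 0 → Attains v (q * L)
    attains-shift* zero    at = at
    attains-shift* {v} (suc q) at =
      subst (Attains v) (+-comm (q * L) L) (attains-shift (attains-shift* q at))

    -- Greedy orbits and full turns.

    fold-shift* : ∀ k q e → fold (e + q * L) E k ≡ fold e E k + q * L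
    fold-shift* zero    q e = refl
    fold-shift* (suc k) q e = trans (cong E (fold-shift* k q e)) (E-shift* q (fold e E k))

    fold-increasing : ∀ e k → e + k ≤ fold e E k
    fold-increasing e zero    = ≤-reflexive (+-identityʳ e)
    fold-increasing e (suc k) = subst (_≤ fold e E (suc k)) (sym (+-suc e k))
      (≤-<-trans (fold-increasing e k) (E-increasing (fold e E k)))

    -- Starts below `L` represent all starts, since `E` commutes with translation by `L`; this makes
    -- the property decidable.
    Turns : ℕ → Set
    Turns k = ∃[ r ] (toℕ {L} r + L ≤ fold (toℕ r) E k)

    turns? : Decidable Turns
    turns? k = any? λ r → toℕ r + L ≤? fold (toℕ r) E k

    -- Every step advances by at least 1. This provides the witness from which the least number of
    -- steps is sought.
    turns-L : Turns L
    turns-L = r , fold-increasing (toℕ r) L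
      where
      r : Fin L
      r = fromℕ< (≤-<-trans z≤n (hi<L v₀))

    ¬turns⇒< : ∀ {k} → ¬ Turns k → ∀ e → fold e E k < e + L
    ¬turns⇒< {k} ¬turns e = begin-strict
      fold e E k             ≡⟨ cong (λ e → fold e E k) e≡ ⟩
      fold (r + q * L) E k   ≡⟨ fold-shift* k q r ⟩
      fold r E k + q * L     <⟨ +-monoˡ-< (q * L) fold<r+L ⟩
      r + L + q * L          ≡⟨ +-assoc r L (q * L) ⟩
      r + suc q * L          ≡⟨ +-suc-turn r q ⟩
      r + q * L + L          ≡⟨ cong (_+ L) e≡ ⟨
      e + L                  ∎
      where
      open ≤-Reasoning
      r q : ℕ
      r = e % L
      q = e / L
      e≡ : e ≡ r + q * L
      e≡ = m≡m%n+[m/n]*n e L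
      fold<r+L : fold r E k < r + L
      fold<r+L = subst (λ r → fold r E k < r + L) (toℕ-fromℕ< (m%n<n e L))
        (≰⇒> λ le → ¬turns (fromℕ< (m%n<n e L) , le))

    -- Corners from a full turn.

    turns⇒corners : ∀ {k} → Turns k → ∃[ cs ] (SatisfiesAll C cs × length cs ≡ k)
    turns⇒corners {k} (r , full) =
      map corner (upTo k) ,
      (λ v → inner-corner v , outer-corner v) ,
      trans (length-map corner (upTo k)) (length-upTo k)
      where
      slot corner : ℕ → ℕ
      -- A corner `c` stands for `c + 1/2`, so the predecessor names the gap just before the end
      -- that is reached.
      slot i = pred (fold (toℕ r) E (suc i))
      corner i = slot i % L

      -- Take the step that jumps over `a`. It ends after `a`, and no later than `b` because the
      -- given arc is a candidate for it.
      hit : ∀ {v a b} → Arc v a b → toℕ r ≤ a → a < toℕ r + L →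
        ∃[ i ] (i < k × a ≤ slot i × slot i < b)
      hit {a = a} {b} arc r≤a a<r+L
        with firstStep (λ i → a <? fold (toℕ r) E i) (≤⇒≯ r≤a) k (<-≤-trans a<r+L full)
      ... | i , i<k , ¬a<i , a<i+1 = i , i<k , <⇒≤pred a<i+1 ,
        <-≤-trans (slot< (≤-<-trans z≤n a<i+1)) (E-minimal (≮⇒≥ ¬a<i) arc)
        where
        slot< : ∀ {x} → 0 < x → pred x < x
        slot< {suc x} _ = ≤-refl

      firstTurn : ∀ {x} → x < L → ∃[ t ] (toℕ r ≤ x + t * L × x + t * L < toℕ r + L)
      firstTurn {x} x<L with toℕ r ≤? x
      ... | yes r≤x = 0 ,
        ≤-trans r≤x (m≤m+n x 0) ,
        subst (_< toℕ r + L) (sym (+-identityʳ x)) (<-≤-trans x<L (m≤n+m L (toℕ r)))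
      ... | no r≰x = 1 ,
        ≤-trans (<⇒≤ (toℕ<n r)) (≤-trans (m≤m+n L 0) (m≤n+m (1 * L) x)) ,
        subst (λ y → x + y < toℕ r + L) (sym (+-identityʳ L)) (+-monoˡ-< L (≰⇒> r≰x))

      %-turn : ∀ d t → d < L → (d + t * L) % L ≡ d
      %-turn d t d<L = trans ([m+kn]%n≡m%n d t L) (m<n⇒m%n≡m d<L)

      inner-% : ∀ {x y c} t → y ≤ L → x + t * L ≤ c → c < y + t * L → x ≤ c % L × c % L < y
      inner-% {x} {y} {c} t y≤L x≤c c<y =
        subst (λ c → x ≤ c × c < y) (sym c%L≡d)
          (+-cancelʳ-≤ (t * L) x d (subst (x + t * L ≤_) c≡ x≤c) , d<y)
        where
        d : ℕ
        d = c ∸ t * L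
        c≡ : c ≡ d + t * L
        c≡ = sym (m∸n+n≡m (≤-trans (m≤n+m (t * L) x) x≤c))
        d<y : d < y
        d<y = +-cancelʳ-< (t * L) d y (subst (_< y + t * L) c≡ c<y)
        c%L≡d : c % L ≡ d
        c%L≡d = trans (cong (_% L) c≡) (%-turn d t (<-≤-trans d<y y≤L))

      outer-% : ∀ {x y c} t → x ≤ L → y + t * L ≤ c → c < x + suc t * L → c % L < x ⊎ y ≤ c % L
      -- `suc t * L` is the lifted cut point inside the outer arc; the side of it on which `c` lies
      -- decides the alternative.
      outer-% {x} {y} {c} t x≤L y≤c c<x with c <? suc t * L
      ... | yes c<t = inj₂ (proj₁ (inner-% t ≤-refl y≤c c<t))
      ... | no  c≮t = inj₁ (proj₂ (inner-% {0} (suc t) x≤L (≮⇒≥ c≮t) c<x))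

      corner∈ : ∀ {i} → i < k → corner i ∈ map corner (upTo k)
      corner∈ i<k = ∈-map⁺ corner (∈-upTo⁺ i<k)

      inner-corner : ∀ v → ∃[ c ] (c ∈ map corner (upTo k) × lo C v ≤ c × c < hi C v)
      inner-corner v with firstTurn (lo<L v)
      ... | t , r≤a , a<r+L with hit (inner t) r≤a a<r+L
      ...   | i , i<k , a≤ , <b = corner i , corner∈ i<k , inner-% t (<⇒≤ (hi<L v)) a≤ <b

      outer-corner : ∀ v → ∃[ c ] (c ∈ map corner (upTo k) × (c < lo C v ⊎ hi C v ≤ c))
      outer-corner v with firstTurn (hi<L v)
      ... | t , r≤a , a<r+L with hit (outer t) r≤a a<r+L
      ...   | i , i<k , a≤ , <b = corner i , corner∈ i<k , outer-% t (<⇒≤ (lo<L v)) a≤ <b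

    -- Clique covers along the greedy orbit.

    separated⇒E²-short : ∀ {u v} → Separated u v → ∃[ e ] (E (E e) < e + L)
    -- Two greedy steps end no later than the inner arc of `u` followed by a disjoint arc of `v`:
    -- the inner one here, the outer one when `v` encloses `u`.
    separated⇒E²-short {u} {v} (before u<v) = lo C u + 0 * L , (begin-strict
      E (E (lo C u + 0 * L))  ≤⟨ E-mono (E-minimal ≤-refl (inner 0)) ⟩
      E (hi C u + 0 * L)      ≤⟨ E-minimal (+-monoˡ-≤ (0 * L) (<⇒≤ u<v)) (inner 0) ⟩
      hi C v + 0 * L          ≡⟨ +-identityʳ (hi C v) ⟩
      hi C v                  <⟨ hi<L v ⟩
      L                       ≤⟨ m≤n+m L _ ⟩
      lo C u + 0 * L + L      ∎)
      where open ≤-Reasoning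
    separated⇒E²-short {u} {v} (inside l h) = lo C u + 0 * L , (begin-strict
      E (E (lo C u + 0 * L))  ≤⟨ E-mono (E-minimal ≤-refl (inner 0)) ⟩
      E (hi C u + 0 * L)      ≤⟨ E-minimal (+-monoˡ-≤ (0 * L) (<⇒≤ h)) (outer 0) ⟩
      lo C v + 1 * L          <⟨ +-monoˡ-< (1 * L) l ⟩
      lo C u + 1 * L          ≡⟨ +-suc-turn (lo C u) 0 ⟩
      lo C u + 0 * L + L      ∎)
      where open ≤-Reasoning

    module Cover {k} (cover : PeripheralCliqueCover C k) where

      colour : Fin n → Fin k
      colour = proj₁ cover

      disjoint⇒colour-≢ : ∀ {u v e e′} → Attains u e → Attains v e′ →
        E e ≤ e′ → E e′ < e + L → colour u ≢ colour v
      disjoint⇒colour-≢ {u} {v} atu@(_ , e≤a , arc) atv@(_ , e′≤a′ , arc′) Ee≤e′ Ee′<e+L eq =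
        apart⇒¬cross apart (proj₂ cover u v (attains⇒peripheral atu) (attains⇒peripheral atv)
          (apart⇒≢ apart) eq)
        where
        apart : Apart u v
        apart = disjoint-arcs⇒apart arc arc′ (≤-trans Ee≤e′ e′≤a′) (<-≤-trans Ee′<e+L (+-monoˡ-≤ L e≤a))

      module Orbit (2≤k : 2 ≤ k) (short : ∀ e → fold e E k < e + L) where

        o : ℕ → ℕ
        o = fold 0 E

        o-mono : ∀ {i j} → i ≤ j → o i ≤ o j
        o-mono i≤j = go (≤⇒≤′ i≤j)
          where
          go : ∀ {i j} → i ≤′ j → o i ≤ o j
          go ≤′-refl           = ≤-refl
          go (≤′-step {j} i≤j) = ≤-trans (go i≤j) (<⇒≤ (E-increasing (o j)))

        o-short : ∀ i → o (k + i) < o i + L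
        o-short i = subst (_< o i + L) (sym (fold-+ 0 E k)) (short (o i))

        chord : ℕ → Fin n
        chord i = proj₁ (attained (o i))

        orbitColour : ℕ → Fin k
        orbitColour i = colour (chord i)

        orbitColour-≢ : ∀ {p q} → p < q → q < k + p → orbitColour p ≢ orbitColour q
        orbitColour-≢ {p} {q} p<q q<k+p =
          disjoint⇒colour-≢ (proj₂ (attained (o p))) (proj₂ (attained (o q)))
            (o-mono p<q) (≤-<-trans (o-mono q<k+p) (o-short p))

        -- Among the `k + 1` indices from `i` to `k + i` two share a colour. Indices closer than `k`
        -- differ in colour, so these two are the extreme ones.
        orbitColour-periodic : ∀ i → orbitColour i ≡ orbitColour (k + i)
        orbitColour-periodic i with pigeonhole (n<1+n k) (λ x → orbitColour (toℕ x + i))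
        ... | x , y , x<y , eq with toℕ y <? k + toℕ x
        ...   | yes y<k+x = contradiction eq (orbitColour-≢ (+-monoˡ-< i x<y)
                  (subst (toℕ y + i <_) (+-assoc k (toℕ x) i) (+-monoˡ-< i y<k+x)))
        ...   | no  y≮k+x = subst₂ (λ x y → orbitColour (x + i) ≡ orbitColour (y + i)) x≡0 y≡k eq
          where
          k+x≤k : k + toℕ x ≤ k
          k+x≤k = ≤-trans (≮⇒≥ y≮k+x) (s≤s⁻¹ (toℕ<n y))
          x≡0 : toℕ x ≡ 0
          x≡0 = n≤0⇒n≡0 (+-cancelˡ-≤ k _ _ (subst (k + toℕ x ≤_) (sym (+-identityʳ k)) k+x≤k))
          y≡k : toℕ y ≡ k
          y≡k = ≤-antisym (s≤s⁻¹ (toℕ<n y)) (≤-trans (m≤m+n k (toℕ x)) (≮⇒≥ y≮k+x))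

        orbitColour-periodic* : ∀ j → orbitColour 0 ≡ orbitColour (j * k)
        orbitColour-periodic* zero    = refl
        orbitColour-periodic* (suc j) =
          trans (orbitColour-periodic* j) (orbitColour-periodic (j * k))

        -- Each round of `k` steps falls short of a turn by at least 1, and the deficits add up.
        drift : ∀ j → o (j * k) + j ≤ j * L
        drift zero    = z≤n
        drift (suc j) = begin
          o (k + j * k) + suc j   ≡⟨ +-suc _ j ⟩
          suc (o (k + j * k)) + j ≤⟨ +-monoˡ-≤ j (o-short (j * k)) ⟩
          o (j * k) + L + j       ≡⟨ cong (_+ j) (+-comm (o (j * k)) L) ⟩
          L + o (j * k) + j       ≡⟨ +-assoc L (o (j * k)) j ⟩
          L + (o (j * k) + j)     ≤⟨ +-monoʳ-≤ L (drift j) ⟩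
          suc j * L               ∎
          where open ≤-Reasoning

        1≤k : 1 ≤ k
        1≤k = ≤-trans (n≤1+n 1) 2≤k

        -- After `suc L` rounds the deficit exceeds a whole turn, so even `o (suc L * k)` lies
        -- before `L * L`.
        drift-L : o (suc (L * k)) < L * L
        drift-L = +-cancelˡ-< L _ _ (begin-strict
          L + o (suc (L * k))     ≤⟨ +-monoʳ-≤ L (o-mono (+-monoˡ-≤ (L * k) 1≤k)) ⟩
          L + o (suc L * k)       ≡⟨ +-comm L _ ⟩
          o (suc L * k) + L       <⟨ +-monoʳ-< (o (suc L * k)) (n<1+n L) ⟩
          o (suc L * k) + suc L   ≤⟨ drift (suc L) ⟩
          L + L * L               ∎)
          where open ≤-Reasoning

        short-turns-impossible : ⊥
        -- Pick `j` such that interval `j * k` still ends at or after `j * L`, while interval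
        -- `suc j * k` ends before `suc j * L`.
        short-turns-impossible with firstStep (λ j → o (suc (j * k)) <? j * L) n≮0 L drift-L
        ... | j , _ , ¬slipped , slipped =
          -- Interval 0 translated by `j * L` ends by `o (2 + j * k)`, hence by `o (suc j * k)` as
          -- `2 ≤ k`. It is thus disjoint from interval `suc j * k`, which has the same colour by
          -- periodicity.
          disjoint⇒colour-≢ (attains-shift* j (proj₂ (attained 0)))
            (proj₂ (attained (o (suc j * k))))
            (≤-trans (E-mono (≮⇒≥ ¬slipped)) (o-mono (+-monoˡ-≤ (j * k) 2≤k)))
            (subst (o (suc (suc j * k)) <_) (+-comm L (j * L)) slipped)
            (orbitColour-periodic* (suc j))

    -- Equality of the two numbers.

    separated⇒2≤k : ∀ {u v k} → Separated u v → PeripheralCliqueCover C k → 2 ≤ k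
    separated⇒2≤k {u} {k = zero} _ cover = case proj₁ cover u of λ ()
    -- Two successive greedy arcs from `e` are disjoint, so a single label cannot serve both chords.
    separated⇒2≤k {k = suc zero} sep cover with separated⇒E²-short sep
    ... | e , E²<e+L =
      contradiction (all-equal _ _) (Cover.disjoint⇒colour-≢ cover
        (proj₂ (attained e)) (proj₂ (attained (E e))) ≤-refl E²<e+L)
      where
      all-equal : (i j : Fin 1) → i ≡ j
      all-equal zero zero = refl
    separated⇒2≤k {k = suc (suc k)} _ _ = s≤s (s≤s z≤n)

    cover⇒turns : ∀ {k} → ¬ (∀ u v → u ≢ v → Cross C u v) → PeripheralCliqueCover C k → Turns k
    cover⇒turns {k} ¬clique cover with turns? k
    ... | yes turns = turns
    ... | no ¬turns = ⊥-elim (¬clique all-cross)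
      where
      ¬separated : ∀ {u v} → ¬ Separated u v
      ¬separated sep = Cover.Orbit.short-turns-impossible cover (separated⇒2≤k sep cover) (¬turns⇒< {k} ¬turns)

      all-cross : ∀ u v → u ≢ v → Cross C u v
      all-cross u v u≢v with cross-or-separated u≢v
      ... | inj₁ x        = x
      ... | inj₂ (inj₁ s) = contradiction s ¬separated
      ... | inj₂ (inj₂ s) = contradiction s ¬separated

    -- The least number of steps making a full turn is both numbers: its corners also label a cover,
    -- and any cover, including one read off from corners, forces a full turn.
    polygon≡cover : ¬ (∀ u v → u ≢ v → Cross C u v) →
      ∃[ k ] (IsPolygonNumber C k × IsPeripheralCliqueCoverNumber C k)
    polygon≡cover ¬clique with least turns? L turns-L
    ... | k , turns , min with turns⇒corners {k} turns
    ...   | cs , sat , eq = k ,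
      ((cs , sat , eq) , λ cs′ sat′ → min _ (cover⇒turns ¬clique (corners⇒cover cs′ sat′))) ,
      (subst (PeripheralCliqueCover C) eq (corners⇒cover cs sat) ,
       λ m cover → min m (cover⇒turns ¬clique cover))

theorem2 : ∀ {n} (G : Graph n) (C : CircleRep n) → ¬ IsClique G → Represents C G →
    ∃[ k ] (IsPolygonNumber C k × IsPeripheralCliqueCoverNumber C k)
-- Without vertices the graph is a clique. Otherwise vertex `zero` serves as `v₀` and shows that `L`
-- is positive.
theorem2 {zero}  G C ¬clique rep = contradiction (λ ()) ¬clique
theorem2 {suc n} G C ¬clique rep with boundedAbove (hi C)
... | L , hi<L = Lift.polygon≡cover C L {{>-nonZero (≤-<-trans z≤n (hi<L zero))}} hi<L zero
  λ all-cross → ¬clique λ u v u≢v → Equivalence.from (rep u v) (all-cross u v u≢v)
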